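{- Let $G$, $H$, $K$ be impartial games with $H = K$. Then $G\circ H = G\circ K$.
   Context: All games are finite (short) impartial games under normal play. A game is identified with its set of options; $\mathbf{E}$ denotes the game with no options, and $\equiv$ denotes identity of games (same set of options, recursively). The disjunctive sum is $G+H \equiv \{g+H,\ G+h\}$. A $\mathcal{P}$-position is a game all of whose options are $\mathcal{N}$-positions; an $\mathcal{N}$-position has some option that is a $\mathcal{P}$-position. Two games are equal, $G=H$, if $G+X$ and $H+X$ have the same outcome for every game $X$; for impartial games this holds iff $G+H$ is a $\mathcal{P}$-position. (Equality is weaker than identity $\equiv$.) The split sum is defined recursively by: $G\circ H \equiv \mathbf{E}$ if $G\equiv \mathbf{E}$; $G\circ H\equiv G$ if $H\equiv\mathbf{E}$ (and $G\not\equiv\mathbf{E}$); otherwise $G\circ H \equiv \{G\circ h,\ g\circ H\}$ where $g$ ranges over the options of $G$ and $h$ over the options of $H$. -}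

module Defs where

open import Data.Nat using (ℕ; zero; suc)
open import Data.Fin using (Fin)
open import Data.Vec.Functional using (Vector; []; _++_)
open import Data.Product using (_×_)
open import Function.Bundles using (_⇔_)

infixl 6 _+_
infixl 7 _∘_
infix  4 _≈_

-- Short impartial games. The finite set of options is given by an enumeration
-- in which order and repetitions carry no meaning; all notions below depend
-- only on the set of options enumerated.
data Game : Set where
  node : (n : ℕ) → Vector Game n → Game

size : Game → ℕ
size (node n _) = n

option : (G : Game) → Vector Game (size G)
option (node _ gs) = gs

E : Game
E = node zero []

_+_ : Game → Game → Game
G@(node _ gs) + H@(node _ hs) = node _ ((λ i → gs i + H) ++ (λ j → G + hs j))

-- A game is identical to E exactly when its enumeration has length zero, so
-- the case distinctions G ≡ E and H ≡ E are made by matching on that length.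
_∘_ : Game → Game → Game
node zero _         ∘ _                 = E
G@(node (suc _) _)  ∘ node zero _       = G
G@(node (suc _) gs) ∘ H@(node (suc _) hs) =
  node _ ((λ j → G ∘ hs j) ++ (λ i → gs i ∘ H))

data 𝒫-position (G : Game) : Set
data 𝒩-position (G : Game) : Set

data 𝒫-position G where
  all𝒩 : (∀ i → 𝒩-position (option G i)) → 𝒫-position G

data 𝒩-position G where
  some𝒫 : ∀ i → 𝒫-position (option G i) → 𝒩-position G

SameOutcome : Game → Game → Set
SameOutcome G H = (𝒫-position G ⇔ 𝒫-position H) × (𝒩-position G ⇔ 𝒩-position H)

-- Equality of games, which is weaker than identity.
_≈_ : Game → Game → Set
G ≈ H = ∀ X → SameOutcome (G + X) (H + X)

{-# OPTIONS --safe #-}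
-- Equality H ≈ K amounts to H + K being a 𝒫-position, so it suffices that
-- (G ∘ H) + (G ∘ K) is a 𝒫-position whenever H + K is. A move to g in one copy
-- of G is answered by the same move in the other copy; a move in H or K is
-- answered by the reply that wins H + K. The reply is always available: a move
-- in H or K only occurs while G ≢ E, and moves in G remain available after
-- H or K has become E, since then G ∘ E ≡ G.
module Submission where

open import Defs
open import Data.Fin using (module Fin; _↑ˡ_; _↑ʳ_; splitAt)
import Data.Nat as ℕ
open import Data.Nat using (zero; suc)
open import Data.Product using (_×_; _,_; ∃-syntax)
open import Data.Sum using (_⊎_; inj₁; inj₂)
open import Data.Vec.Functional using (Vector; _++_)
open import Data.Vec.Functional.Properties using (lookup-++ˡ; lookup-++ʳ)
open import Function.Bundles using (mk⇔; module Equivalence)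
open import Relation.Binary.PropositionalEquality using (subst)

infix 4 _⊰_

-- Indexed so that matching on `opt i` exposes the enumeration and makes the option a subterm, on
-- which the later recursions descend.
data _⊰_ : Game → Game → Set where
  opt : ∀ {n} {gs : Vector Game n} i → gs i ⊰ node n gs

⊰-++ˡ : ∀ {m n} (xs : Vector Game m) (ys : Vector Game n) i →
        xs i ⊰ node (m ℕ.+ n) (xs ++ ys)
⊰-++ˡ xs ys i = subst (_⊰ node _ (xs ++ ys)) (lookup-++ˡ xs ys i) (opt (i ↑ˡ _))

⊰-++ʳ : ∀ {m n} (xs : Vector Game m) (ys : Vector Game n) j →
        ys j ⊰ node (m ℕ.+ n) (xs ++ ys)
⊰-++ʳ {m} xs ys j = subst (_⊰ node _ (xs ++ ys)) (lookup-++ʳ xs ys j) (opt (m ↑ʳ j))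

⊰-++⁻ : ∀ {m n} (xs : Vector Game m) (ys : Vector Game n) {x} →
        x ⊰ node (m ℕ.+ n) (xs ++ ys) → x ⊰ node m xs ⊎ x ⊰ node n ys
⊰-++⁻ {m} xs ys (opt i) with splitAt m i
... | inj₁ j = inj₁ (opt j)
... | inj₂ j = inj₂ (opt j)

𝒫⇒𝒩 : ∀ {G g} → 𝒫-position G → g ⊰ G → 𝒩-position g
𝒫⇒𝒩 (all𝒩 f) (opt i) = f i

𝒫-intro : ∀ {G} → (∀ {g} → g ⊰ G → 𝒩-position g) → 𝒫-position G
𝒫-intro {node _ _} f = all𝒩 λ i → f (opt i)

𝒩-intro : ∀ {G g} → g ⊰ G → 𝒫-position g → 𝒩-position G
𝒩-intro (opt i) p = some𝒫 i p

𝒩⇒𝒫 : ∀ {G} → 𝒩-position G → ∃[ g ] g ⊰ G × 𝒫-position g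
𝒩⇒𝒫 {node _ _} (some𝒫 i p) = _ , opt i , p

data SumOption (G H : Game) : Game → Set where
  left  : ∀ {g} → g ⊰ G → SumOption G H (g + H)
  right : ∀ {h} → h ⊰ H → SumOption G H (G + h)

+-option⁻ : ∀ G H {x} → x ⊰ G + H → SumOption G H x
+-option⁻ G@(node _ gs) H@(node _ hs) x⊰
  with ⊰-++⁻ (λ i → gs i + H) (λ j → G + hs j) x⊰
... | inj₁ (opt i) = left (opt i)
... | inj₂ (opt j) = right (opt j)

+-optionˡ : ∀ {G g} H → g ⊰ G → g + H ⊰ G + H
+-optionˡ {G@(node _ gs)} H@(node _ hs) (opt i) =
  ⊰-++ˡ (λ i → gs i + H) (λ j → G + hs j) i

+-optionʳ : ∀ G {H h} → h ⊰ H → G + h ⊰ G + H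
+-optionʳ G@(node _ gs) {H@(node _ hs)} (opt j) =
  ⊰-++ʳ (λ i → gs i + H) (λ j → G + hs j) j

𝒫-+-intro : ∀ {G H} →
            (∀ {g} → g ⊰ G → 𝒩-position (g + H)) →
            (∀ {h} → h ⊰ H → 𝒩-position (G + h)) →
            𝒫-position (G + H)
𝒫-+-intro {G} {H} l r = 𝒫-intro λ x⊰ → reply (+-option⁻ G H x⊰)
  where
  reply : ∀ {x} → SumOption G H x → 𝒩-position x
  reply (left g⊰)  = l g⊰
  reply (right h⊰) = r h⊰

data WinningMove (G H : Game) : Set where
  left  : ∀ {g} → g ⊰ G → 𝒫-position (g + H) → WinningMove G H
  right : ∀ {h} → h ⊰ H → 𝒫-position (G + h) → WinningMove G H

winningMove : ∀ G H → 𝒩-position (G + H) → WinningMove G H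
winningMove G H n with 𝒩⇒𝒫 n
... | _ , x⊰ , p with +-option⁻ G H x⊰
...   | left g⊰  = left g⊰ p
...   | right h⊰ = right h⊰ p

𝒫-+ˡ : ∀ {G H g} → 𝒫-position (G + H) → g ⊰ G → 𝒩-position (g + H)
𝒫-+ˡ {H = H} p g⊰ = 𝒫⇒𝒩 p (+-optionˡ H g⊰)

𝒫-+ʳ : ∀ {G H h} → 𝒫-position (G + H) → h ⊰ H → 𝒩-position (G + h)
𝒫-+ʳ {G} p h⊰ = 𝒫⇒𝒩 p (+-optionʳ G h⊰)

𝒩-+ˡ : ∀ {G H g} → g ⊰ G → 𝒫-position (g + H) → 𝒩-position (G + H)
𝒩-+ˡ {H = H} g⊰ = 𝒩-intro (+-optionˡ H g⊰)

𝒩-+ʳ : ∀ {G H h} → h ⊰ H → 𝒫-position (G + h) → 𝒩-position (G + H)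
𝒩-+ʳ {G} h⊰ = 𝒩-intro (+-optionʳ G h⊰)

mutual
  -- The two sums list their options in different orders at every level, so symmetry is proved for
  -- outcomes.
  𝒫-+-comm : ∀ G H → 𝒫-position (G + H) → 𝒫-position (H + G)
  𝒫-+-comm G H p = 𝒫-+-intro
    (λ { (opt j) → 𝒩-+-comm G _ (𝒫-+ʳ p (opt j)) })
    (λ { (opt i) → 𝒩-+-comm _ H (𝒫-+ˡ p (opt i)) })

  𝒩-+-comm : ∀ G H → 𝒩-position (G + H) → 𝒩-position (H + G)
  𝒩-+-comm G H n with winningMove G H n
  ... | left  (opt i) p = 𝒩-+ʳ (opt i) (𝒫-+-comm _ H p)
  ... | right (opt j) p = 𝒩-+ˡ (opt j) (𝒫-+-comm G _ p)

-- Mirror strategy: a move in one copy is answered by the same move in the other.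
𝒫-double : ∀ G → 𝒫-position (G + G)
𝒫-double G = 𝒫-+-intro
  (λ { (opt i) → 𝒩-+ʳ (opt i) (𝒫-double _) })
  (λ { (opt i) → 𝒩-+ˡ (opt i) (𝒫-double _) })

mutual
  -- The hypotheses are symmetric in `B` and `X`, so a move in either is handled by `𝒩-transfer`,
  -- with the two exchanged for a move in `B`.
  𝒫-transfer : ∀ A B X → 𝒫-position (A + B) → 𝒫-position (A + X) → 𝒫-position (B + X)
  𝒫-transfer A B X p q = 𝒫-+-intro
    (λ { (opt i) → 𝒩-+-comm X _ (𝒩-transfer A X _ q (𝒫-+ʳ p (opt i))) })
    (λ { (opt j) → 𝒩-transfer A B _ p (𝒫-+ʳ q (opt j)) })

  𝒩-transfer : ∀ A B X → 𝒫-position (A + B) → 𝒩-position (A + X) → 𝒩-position (B + X)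
  𝒩-transfer A B X p n with winningMove A X n
  -- For this option `a` of `A`, `a + X` is a 𝒫-position and `a + B` an 𝒩-position, so induction
  -- applies with `a` for `A` and `B`, `X` exchanged.
  ... | left  (opt i) q = 𝒩-+-comm X B (𝒩-transfer _ X B q (𝒫-+ˡ p (opt i)))
  ... | right (opt j) q = 𝒩-+ʳ (opt j) (𝒫-transfer A B _ p q)

-- The test game is `H` itself, because `H + H` is a 𝒫-position.
≈⇒𝒫 : ∀ {G H} → G ≈ H → 𝒫-position (G + H)
≈⇒𝒫 {H = H} G≈H with G≈H H
... | 𝒫⇔ , _ = Equivalence.from 𝒫⇔ (𝒫-double H)

𝒫⇒≈ : ∀ {G H} → 𝒫-position (G + H) → G ≈ H
𝒫⇒≈ {G} {H} p X =
  mk⇔ (𝒫-transfer G H X p) (𝒫-transfer H G X p′) ,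
  mk⇔ (𝒩-transfer G H X p) (𝒩-transfer H G X p′)
  where p′ = 𝒫-+-comm G H p

-- G ∘ E and G need not be propositionally equal when G has no options, since
-- functions out of Fin 0 are not; hence the second constructor.
data Split (G : Game) : Game → Game → Set where
  split : ∀ {H} → Split G H (G ∘ H)
  unit  : ∀ {hs} → Split G (node zero hs) G

-- `right` carries an option of `G` as evidence that `G` is not `E`, since only then can a move be
-- made in `H`.
data SplitOption (G H x : Game) : Set where
  left  : ∀ {g} → g ⊰ G → Split g H x → SplitOption G H x
  right : ∀ {g h} → g ⊰ G → h ⊰ H → Split G h x → SplitOption G H x

Split-option⁻ : ∀ {G H X x} → Split G H X → x ⊰ X → SplitOption G H x
Split-option⁻ unit x⊰ = left x⊰ unit
Split-option⁻ {node zero _} split (opt ())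
Split-option⁻ {node (suc _) _} {node zero _} split x⊰ = left x⊰ unit
Split-option⁻ {G@(node (suc _) gs)} {H@(node (suc _) hs)} split x⊰
  with ⊰-++⁻ (λ j → G ∘ hs j) (λ i → gs i ∘ H) x⊰
-- `G` has at least one option here, so index zero supplies the evidence.
... | inj₁ (opt j) = right (opt Fin.zero) (opt j) split
... | inj₂ (opt i) = left (opt i) split

Split-optionˡ : ∀ {G H X g} → Split G H X → g ⊰ G → ∃[ x ] x ⊰ X × Split g H x
Split-optionˡ unit g⊰ = _ , g⊰ , unit
Split-optionˡ {node zero _} split (opt ())
Split-optionˡ {node (suc _) _} {node zero _} split g⊰ = _ , g⊰ , unit
Split-optionˡ {G@(node (suc _) gs)} {H@(node (suc _) hs)} split (opt i) =
  _ , ⊰-++ʳ (λ j → G ∘ hs j) (λ i → gs i ∘ H) i , split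

-- The option of `H` excludes `unit`, and the option of `G` excludes a collapse of `G ∘ H` to `E`.
Split-optionʳ : ∀ {G H X g h} → Split G H X → g ⊰ G → h ⊰ H → ∃[ x ] x ⊰ X × Split G h x
Split-optionʳ {node zero _} split (opt ()) _
Split-optionʳ {G@(node (suc _) gs)} {H@(node (suc _) hs)} split _ (opt j) =
  _ , ⊰-++ˡ (λ j → G ∘ hs j) (λ i → gs i ∘ H) j , split

mutual
  -- Stated for all `X` and `Y` related by `Split`, so that the induction continues through `unit`
  -- once `H` or `K` has run out.
  Split-𝒫 : ∀ G H K {X Y} → Split G H X → Split G K Y →
            𝒫-position (H + K) → 𝒫-position (X + Y)
  Split-𝒫 G H K {X} {Y} s t p = 𝒫-+-intro replyˡ replyʳ
    where
    replyˡ : ∀ {x} → x ⊰ X → 𝒩-position (x + Y)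
    replyˡ x⊰ with Split-option⁻ s x⊰
    ... | right g⊰ (opt i) s′ = Split-𝒩 G _ K g⊰ s′ t (𝒫-+ˡ p (opt i))
    ... | left (opt i) s′ with Split-optionˡ t (opt i)
    -- Copying the move in `G` leaves `H + K` untouched.
    ...   | _ , y⊰ , t′ = 𝒩-+ʳ y⊰ (Split-𝒫 _ H K s′ t′ p)

    replyʳ : ∀ {y} → y ⊰ Y → 𝒩-position (X + y)
    replyʳ y⊰ with Split-option⁻ t y⊰
    ... | right g⊰ (opt j) t′ = Split-𝒩 G H _ g⊰ s t′ (𝒫-+ʳ p (opt j))
    ... | left (opt i) t′ with Split-optionˡ s (opt i)
    ...   | _ , x⊰ , s′ = 𝒩-+ˡ x⊰ (Split-𝒫 _ H K s′ t′ p)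

  -- The winning move of `H + K`, in whichever summand it lies, can be played in `X + Y` because `G`
  -- still has an option.
  Split-𝒩 : ∀ G H K {X Y g} → g ⊰ G → Split G H X → Split G K Y →
            𝒩-position (H + K) → 𝒩-position (X + Y)
  Split-𝒩 G H K g⊰ s t n with winningMove H K n
  ... | left (opt i) p with Split-optionʳ s g⊰ (opt i)
  ...   | _ , x⊰ , s′ = 𝒩-+ˡ x⊰ (Split-𝒫 G _ K s′ t p)
  Split-𝒩 G H K g⊰ s t n | right (opt j) p with Split-optionʳ t g⊰ (opt j)
  ...   | _ , y⊰ , t′ = 𝒩-+ʳ y⊰ (Split-𝒫 G H _ s t′ p)

theorem2p5 : (G H K : Game) → H ≈ K → (G ∘ H) ≈ (G ∘ K)
theorem2p5 G H K H≈K = 𝒫⇒≈ (Split-𝒫 G H K split split (≈⇒𝒫 H≈K))
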